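{- Let $G$ be a connected graph of order $n$ with minimum degree $\delta=\delta(G)\geq 1+\sqrt{3n+4}$. Then $$prc(G)-rc(G)\geq \delta-\Big(\frac{3n}{\delta+1}+3\Big).$$
   Context: A path in an edge-coloured graph is a rainbow path if its edges receive pairwise distinct colours. The rainbow connection number $rc(G)$ of a connected graph $G$ is the minimum number of colours in an edge-colouring such that every two distinct vertices are joined by a rainbow path. The proper rainbow connection number $prc(G)$ is the minimum number of colours in a proper edge-colouring (adjacent edges get distinct colours) such that every two distinct vertices are joined by a rainbow path. -}

module Defs where

open import Data.Fin using (Fin)
open import Data.Integer as ℤ using (ℤ)
open import Data.List using (List; []; _∷_; length; filter; allFin)
open import Data.List.Relation.Unary.Unique.Propositional using (Unique)
open import Data.Nat using (ℕ; _≤_)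
open import Data.Product using (∃; ∃-syntax; _×_)
open import Level using (0ℓ)
open import Relation.Binary using (Rel; Decidable; Symmetric; Irreflexive)
open import Relation.Binary.Construct.Closure.ReflexiveTransitive using (Star; ε; _◅_)
open import Relation.Binary.PropositionalEquality using (_≡_; _≢_)

-- Finite simple graphs of order n.  Adjacency is required to be decidable so
-- that degrees can be counted.
record Graph (n : ℕ) : Set₁ where
  field
    Adj         : Rel (Fin n) 0ℓ
    adjacent?   : Decidable Adj
    symmetric   : Symmetric Adj
    irreflexive : Irreflexive _≡_ Adj

open Graph public

degree : ∀ {n} → Graph n → Fin n → ℕ
degree {n} G v = length (filter (adjacent? G v) (allFin n))

Walk : ∀ {n} → Graph n → Rel (Fin n) 0ℓ
Walk G = Star (Adj G)

vertices : ∀ {n} (G : Graph n) {u v} → Walk G u v → List (Fin n)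
vertices G {u} ε       = u ∷ []
vertices G {u} (_ ◅ w) = u ∷ vertices G w

IsPath : ∀ {n} (G : Graph n) {u v} → Walk G u v → Set
IsPath G w = Unique (vertices G w)

Connected : ∀ {n} → Graph n → Set
Connected G = ∀ u v → ∃[ w ] IsPath G {u} {v} w

-- An edge-colouring with colours from Fin k, not all of which need be used.
-- `undirected` makes the colour depend only on the edge {u , v}: neither the
-- orientation nor the proof of adjacency matters (apply it twice for the
-- latter).
record EdgeColouring {n} (G : Graph n) (k : ℕ) : Set where
  field
    colour     : ∀ {u v} → Adj G u v → Fin k
    undirected : ∀ {u v} (e : Adj G u v) (e′ : Adj G v u) → colour e ≡ colour e′

open EdgeColouring public

module _ {n} {G : Graph n} {k} (c : EdgeColouring G k) where

  Proper : Set
  Proper = ∀ {u v w} (e : Adj G u v) (f : Adj G u w) → v ≢ w → colour c e ≢ colour c f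

  colours : ∀ {u v} → Walk G u v → List (Fin k)
  colours ε       = []
  colours (e ◅ w) = colour c e ∷ colours w

  IsRainbowPath : ∀ {u v} → Walk G u v → Set
  IsRainbowPath w = IsPath G w × Unique (colours w)

  RainbowConnected : Set
  RainbowConnected = ∀ u v → u ≢ v → ∃[ w ] IsRainbowPath {u} {v} w

IsMinimum : (ℕ → Set) → ℕ → Set
IsMinimum P m = P m × (∀ k → P k → m ≤ k)

IsMinDegree : ∀ {n} → Graph n → ℕ → Set
IsMinDegree G = IsMinimum λ d → ∃[ v ] degree G v ≡ d

IsRc : ∀ {n} → Graph n → ℕ → Set
IsRc G = IsMinimum λ k → ∃ λ (c : EdgeColouring G k) → RainbowConnected c

IsPrc : ∀ {n} → Graph n → ℕ → Set
IsPrc G = IsMinimum λ k → ∃ λ (c : EdgeColouring G k) → Proper c × RainbowConnected c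

-- x ≥√ y says x ≥ √y for the real square root, without mentioning reals.
-- The sign condition is needed since x may be negative.
infix 4 _≥√_

_≥√_ : ℤ → ℕ → Set
x ≥√ y = ℤ.0ℤ ℤ.≤ x × ℤ.+ y ℤ.≤ x ℤ.* x

{-# OPTIONS --safe #-}
-- A proper colouring gives the edges at a vertex distinct colours, so prc ≥ δ.
-- It remains to show rc ≤ 3n/(δ+1) + 3, which is a theorem of Chandran, Das,
-- Rajendraprasad and Varma.  Grow a connected set D, the core, until every
-- vertex outside D has a neighbour in D ("near") or else two near neighbours
-- ("far").  As long as this fails, either three new vertices of D dominate at
-- least δ+1 new vertices or two dominate at least δ, so in the end
-- |D| + 2 ≤ 3n/(δ+1).  The core is rainbow connected with |D|-1 colours.
--
-- Six further colours 0, …, 5 suffice for the rest.  Call two near vertices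
-- linked if they are adjacent or have a common far neighbour, and split the
-- near vertices into two sides such that every vertex with a link has one to
-- the other side.  A near vertex of side t reaches D by the colour t of its own
-- side, and also without this colour: by a second edge to D, or through the
-- other side.  The edge from a far vertex to a near vertex of side t is coloured
-- 2 + t if the far vertex sees both sides, and 4 or 5 otherwise.  Any two
-- vertices then have routes to D with disjoint sets of colours.
module Submission where

open import Data.Bool using (Bool; true; false; not; if_then_else_)
import Data.Bool.Properties as Boolₚ
open import Data.Fin as Fin using (Fin; fromℕ<; toℕ)
open import Data.Fin.Properties using (_≟_; any?; injective⇒≤; fromℕ<-cong; toℕ-fromℕ<)
open import Data.Integer as ℤ using (+_; 1ℤ)
import Data.Integer.Properties as ℤₚ
open import Data.List
  using (List; []; _∷_; _++_; length; filter; allFin; lookup; map; reverse; reverseAcc)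
import Data.List.Membership.DecPropositional as DecMembership
open import Data.List.Membership.Propositional using (_∈_; _∉_; find)
open import Data.List.Membership.Propositional.Properties
  using (∈-allFin; ∈-filter⁺; ∈-length; ∈-lookup)
open import Data.List.Properties using (length-filter; length-tabulate)
open import Data.List.Relation.Binary.Permutation.Propositional using (↭-sym; ↭⇒↭ₛ)
open import Data.List.Relation.Binary.Permutation.Propositional.Properties
  using (↭-reverse; All-resp-↭)
import Data.List.Relation.Binary.Permutation.Setoid.Properties as ↭ₛ
open import Data.List.Relation.Unary.All as All using (All; []; _∷_)
import Data.List.Relation.Unary.All.Properties as Allₚ
open import Data.List.Relation.Unary.AllPairs using ([]; _∷_)
open import Data.List.Relation.Unary.Any as Any using (Any; here; there)
open import Data.List.Relation.Unary.Unique.Propositional using (Unique)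
import Data.List.Relation.Unary.Unique.Propositional.Properties as Uniqueₚ
open import Data.Nat as ℕ using (ℕ; zero; suc; _+_; _*_; _≤_; _<_; z≤n; s≤s)
import Data.Nat.Properties as ℕₚ
open import Data.Nat.Tactic.RingSolver using (solve-∀)
open import Data.Product using (∃; _×_; _,_; proj₁; proj₂)
open import Data.Rational as ℚ using (_/_; _-_; _≥_)
import Data.Rational.Properties as ℚₚ
open import Data.Rational.Unnormalised as ℚᵘ using (mkℚᵘ)
import Data.Rational.Unnormalised.Properties as ℚᵘₚ
open import Data.Sum using (_⊎_; inj₁; inj₂; [_,_]′)
open import Data.Unit using (⊤)
open import Function using (_∘_; id)
open import Relation.Binary.Construct.Closure.ReflexiveTransitive using (ε; _◅_)
open import Relation.Binary.PropositionalEquality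
  using (_≡_; _≢_; refl; sym; trans; cong; cong₂; subst; subst₂; setoid)
open import Relation.Nullary
  using (Dec; yes; no; does; ¬_; ¬?; _×-dec_; _⊎-dec_; contradiction)
open import Relation.Nullary.Decidable
  using (dec-true; dec-false; decidable-stable; from-yes)
open import Relation.Unary using (Decidable; _⊆_)
open import Defs

-- Counting with filtered lists

module _ {A : Set} {P Q R : A → Set} (P? : Decidable P) (Q? : Decidable Q) (R? : Decidable R) where

  length-filter-disjoint : P ⊆ R → Q ⊆ R → (∀ {x} → P x → ¬ Q x) → ∀ xs →
    length (filter P? xs) + length (filter Q? xs) ≤ length (filter R? xs)
  length-filter-disjoint P⊆R Q⊆R P#Q [] = z≤n
  length-filter-disjoint P⊆R Q⊆R P#Q (x ∷ xs)
    with ih ← length-filter-disjoint P⊆R Q⊆R P#Q xs | P? x | Q? x | R? x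
  ... | yes p | yes q | _     = contradiction q (P#Q p)
  ... | yes p | no  _ | no ¬r = contradiction (P⊆R p) ¬r
  ... | no  _ | yes q | no ¬r = contradiction (Q⊆R q) ¬r
  ... | yes _ | no  _ | yes _ = s≤s ih
  ... | no  _ | yes _ | yes _ = ℕₚ.≤-trans (ℕₚ.≤-reflexive (ℕₚ.+-suc _ _)) (s≤s ih)
  ... | no  _ | no  _ | yes _ = ℕₚ.m≤n⇒m≤1+n ih
  ... | no  _ | no  _ | no  _ = ih

  length-filter-cover : (∀ {x} → P x → Q x ⊎ R x) → ∀ xs →
    length (filter P? xs) ≤ length (filter Q? xs) + length (filter R? xs)
  length-filter-cover P⊆Q∪R [] = z≤n
  length-filter-cover P⊆Q∪R (x ∷ xs)
    with ih ← length-filter-cover P⊆Q∪R xs | P? x | Q? x | R? x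
  ... | yes p | no ¬q | no ¬r = contradiction (P⊆Q∪R p) [ ¬q , ¬r ]′
  ... | yes _ | no  _ | yes _ = ℕₚ.≤-trans (s≤s ih) (ℕₚ.≤-reflexive (sym (ℕₚ.+-suc _ _)))
  ... | yes _ | yes _ | yes _ = s≤s
        (ℕₚ.≤-trans ih (ℕₚ.+-monoʳ-≤ (length (filter Q? xs)) (ℕₚ.n≤1+n _)))
  ... | yes _ | yes _ | no  _ = s≤s ih
  ... | no  _ | no  _ | no  _ = ih
  ... | no  _ | no  _ | yes _ = ℕₚ.≤-trans (ℕₚ.m≤n⇒m≤1+n ih) (ℕₚ.≤-reflexive (sym (ℕₚ.+-suc _ _)))
  ... | no  _ | yes _ | no  _ = ℕₚ.m≤n⇒m≤1+n ih
  ... | no  _ | yes _ | yes _ = ℕₚ.m≤n⇒m≤1+n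
        (ℕₚ.≤-trans ih (ℕₚ.+-monoʳ-≤ (length (filter Q? xs)) (ℕₚ.n≤1+n _)))

count : ∀ {n} {P : Fin n → Set} → Decidable P → ℕ
count P? = length (filter P? (allFin _))

count-≡-≥1 : ∀ {n} (v : Fin n) → 1 ≤ count (_≟ v)
count-≡-≥1 v = ∈-length (∈-filter⁺ (_≟ v) (∈-allFin v) refl)

unique-constant⇒length≤1 : ∀ {A : Set} {v : A} {xs} → Unique xs → All (_≡ v) xs → length xs ≤ 1
unique-constant⇒length≤1 []                _                 = z≤n
unique-constant⇒length≤1 (_ ∷ [])          _                 = s≤s z≤n
unique-constant⇒length≤1 ((x≢y ∷ _) ∷ _ ∷ _) (refl ∷ refl ∷ _) = contradiction refl x≢y

count-≡-≤1 : ∀ {n} (v : Fin n) → count (_≟ v) ≤ 1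
count-≡-≤1 v = unique-constant⇒length≤1
  (Uniqueₚ.filter⁺ (_≟ v) (Uniqueₚ.allFin⁺ _)) (Allₚ.all-filter (_≟ v) (allFin _))

lookup-injective : ∀ {A : Set} {xs : List A} → Unique xs → ∀ {i j} → lookup xs i ≡ lookup xs j → i ≡ j
lookup-injective (_ ∷ _)    {Fin.zero}  {Fin.zero}  eq = refl
lookup-injective (x∉ ∷ _)   {Fin.zero}  {Fin.suc j} eq = contradiction eq (All.lookup x∉ (∈-lookup j))
lookup-injective (x∉ ∷ _)   {Fin.suc i} {Fin.zero}  eq = contradiction (sym eq) (All.lookup x∉ (∈-lookup i))
lookup-injective (_ ∷ uniq) {Fin.suc i} {Fin.suc j} eq = cong Fin.suc (lookup-injective uniq eq)

-- Degrees in proper colourings, and cutting walks down to paths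

module _ {n} {G : Graph n} {k} (c : EdgeColouring G k) where

  -- Indexing the repetition-free neighbour list of `v` and taking edge colours is an injection into
  -- the `k` colours.
  degree≤colours : Proper c → ∀ v → degree G v ≤ k
  degree≤colours proper v = injective⇒≤ {f = colour c ∘ edge} λ {i} {j} eq →
    decidable-stable (i ≟ j) λ i≢j → proper (edge i) (edge j)
      (i≢j ∘ lookup-injective (Uniqueₚ.filter⁺ (adjacent? G v) (Uniqueₚ.allFin⁺ n))) eq
    where
    edge : ∀ i → Adj G v (lookup (filter (adjacent? G v) (allFin n)) i)
    edge i = All.lookup (Allₚ.all-filter (adjacent? G v) (allFin n)) (∈-lookup i)

  -- Serves to cut out a cycle: when a vertex recurs, the walk restarts at the later occurrence.
  -- Dropping initial edges keeps vertices and colours distinct and adds no colour.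
  suffix : ∀ {u v} (w : Walk G u v) {x} → x ∈ vertices G w → ∃ λ (w′ : Walk G x v) →
    (IsPath G w → IsPath G w′) × (Unique (colours c w) → Unique (colours c w′)) ×
    (∀ {i} → i ∈ colours c w′ → i ∈ colours c w)
  suffix ε       (here refl) = ε , id , id , id
  suffix (e ◅ w) (here refl) = e ◅ w , id , id , id
  suffix (e ◅ w) (there x∈w) with w′ , path , uniq , sub ← suffix w x∈w =
    w′ , (λ { (_ ∷ p) → path p }) , (λ { (_ ∷ p) → uniq p }) , there ∘ sub

  -- Removing cycles only deletes edges, so distinct colours stay distinct, and rainbow walks are
  -- enough for rainbow connection. The inclusion of colours keeps the induction going: the colour
  -- of `e` must be absent from the shortened tail.
  rainbowWalk⇒rainbowPath : ∀ {u v} (w : Walk G u v) → Unique (colours c w) →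
    ∃ λ (w′ : Walk G u v) → IsRainbowPath c w′ × (∀ {i} → i ∈ colours c w′ → i ∈ colours c w)
  rainbowWalk⇒rainbowPath ε _ = ε , ([] ∷ [] , []) , id
  rainbowWalk⇒rainbowPath {u} (e ◅ w) (e∉w ∷ uniq)
    with w′ , (path , rainbow) , sub ← rainbowWalk⇒rainbowPath w uniq
    with DecMembership._∈?_ _≟_ u (vertices G w′)
  ... | yes u∈w′ with w″ , path′ , rainbow′ , sub′ ← suffix w′ u∈w′ =
        w″ , (path′ path , rainbow′ rainbow) , there ∘ sub ∘ sub′
  ... | no  u∉w′ = e ◅ w′ ,
        (Allₚ.¬Any⇒All¬ _ u∉w′ ∷ path , All.tabulate (All.lookup e∉w ∘ sub) ∷ rainbow) ,
        λ { (here eq) → here eq ; (there i∈) → there (sub i∈) }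

-- Rainbow trails with restricted palettes

module _ {V : Set} where

  data Trail (E : V → V → ℕ → Set) : V → V → List ℕ → Set where
    []  : ∀ {u} → Trail E u u []
    _∷_ : ∀ {u v w k ks} → E u v k → Trail E v w ks → Trail E u w (k ∷ ks)

  private variable
    E E′ : V → V → ℕ → Set
    P Q : ℕ → Set
    u v w : V

  trail-map : (∀ {u v k} → E u v k → E′ u v k) → ∀ {ks} → Trail E u v ks → Trail E′ u v ks
  trail-map f []      = []
  trail-map f (e ∷ t) = f e ∷ trail-map f t

  trail-++ : ∀ {ks ls} → Trail E u v ks → Trail E v w ls → Trail E u w (ks ++ ls)
  trail-++ []      s = s
  trail-++ (e ∷ t) s = e ∷ trail-++ t s

  trail-reverseAcc : (∀ {u v k} → E u v k → E v u k) → ∀ {ks ls} →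
    Trail E u v ks → Trail E u w ls → Trail E v w (reverseAcc ls ks)
  trail-reverseAcc s []      acc = acc
  trail-reverseAcc s (e ∷ t) acc = trail-reverseAcc s t (s e ∷ acc)

  -- The predicate `P` bounds the palette, so that trails with disjoint palettes can be
  -- concatenated. Vertices may repeat; paths are extracted at the very end.
  Rainbow : (V → V → ℕ → Set) → (ℕ → Set) → V → V → Set
  Rainbow E P u v = ∃ λ ks → Trail E u v ks × Unique ks × All P ks

  rainbow-refl : Rainbow E P u u
  rainbow-refl = [] , [] , [] , []

  rainbow-edge : ∀ {k} → E u v k → P k → Rainbow E P u v
  rainbow-edge e p = _ , e ∷ [] , [] ∷ [] , p ∷ []

  rainbow-map : (∀ {u v k} → E u v k → E′ u v k) → (∀ {k} → P k → Q k) →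
    Rainbow E P u v → Rainbow E′ Q u v
  rainbow-map f g (ks , t , uniq , ps) = ks , trail-map f t , uniq , All.map g ps

  rainbow-sym : (∀ {u v k} → E u v k → E v u k) → Rainbow E P u v → Rainbow E P v u
  rainbow-sym s (ks , t , uniq , ps) =
    reverse ks , trail-reverseAcc s t [] ,
    ↭ₛ.Unique-resp-↭ (setoid ℕ) (↭⇒↭ₛ (↭-sym (↭-reverse ks))) uniq ,
    All-resp-↭ (↭-sym (↭-reverse ks)) ps

  rainbow-trans : (∀ {k} → P k → ¬ Q k) → Rainbow E P u v → Rainbow E Q v w →
    Rainbow E (λ k → P k ⊎ Q k) u w
  rainbow-trans P#Q (ks , t , uniq , ps) (ls , s , uniq′ , qs) =
    ks ++ ls , trail-++ t s ,
    Uniqueₚ.++⁺ uniq uniq′ (λ (i∈ks , i∈ls) → P#Q (All.lookup ps i∈ks) (All.lookup qs i∈ls)) ,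
    Allₚ.++⁺ (All.map inj₁ ps) (All.map inj₂ qs)

-- Splitting vertices into two sides

module _ {n} {E : Fin n → Fin n → Set} (E? : ∀ x y → Dec (E x y)) where

  open DecMembership (_≟_ {n}) using (_∈?_)

  -- The two sides are a maximal independent set and its complement.
  opposite-neighbours : (∀ {x y} → E x y → E y x) → (∀ {x} → ¬ E x x) →
    ∃ λ (side : Fin n → Bool) → ∀ {x y} → E x y → ∃ λ z → E x z × side z ≡ not (side x)
  opposite-neighbours E-sym E-irrefl = side , opposite
    where
    maximal : ∀ xs → ∃ λ I → (∀ {x y} → x ∈ I → y ∈ I → ¬ E x y) ×
      All (λ x → x ∈ I ⊎ ∃ λ y → y ∈ I × E x y) xs
    maximal [] = [] , (λ ()) , []
    maximal (x ∷ xs) with I , indep , dom ← maximal xs | any? (λ y → (y ∈? I) ×-dec E? x y)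
    ... | yes found = I , indep , inj₂ found ∷ dom
    ... | no ¬found = x ∷ I , indep′ , inj₁ (here refl) ∷
            All.map (λ { (inj₁ x∈) → inj₁ (there x∈)
                       ; (inj₂ (y , y∈ , e)) → inj₂ (y , there y∈ , e) }) dom
      where
      indep′ : ∀ {a b} → a ∈ x ∷ I → b ∈ x ∷ I → ¬ E a b
      indep′ (here refl) (here refl) e = E-irrefl e
      indep′ (here refl) (there b∈)  e = ¬found (_ , b∈ , e)
      indep′ (there a∈)  (here refl) e = ¬found (_ , a∈ , E-sym e)
      indep′ (there a∈)  (there b∈)  e = indep a∈ b∈ e
    I = proj₁ (maximal (allFin n))
    indep = proj₁ (proj₂ (maximal (allFin n)))
    side : Fin n → Bool
    side x = does (x ∈? I)
    opposite : ∀ {x y} → E x y → ∃ λ z → E x z × side z ≡ not (side x)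
    opposite {x} {y} e with x ∈? I | All.lookup (proj₂ (proj₂ (maximal (allFin n)))) (∈-allFin x)
    ... | yes x∈ | _ = y , e , dec-false (y ∈? I) (λ y∈ → indep x∈ y∈ e)
    ... | no x∉  | inj₁ x∈ = contradiction x∈ x∉
    ... | no x∉  | inj₂ (z , z∈ , e′) = z , e′ , dec-true (z ∈? I) z∈

-- Growing the core

module _ {n} (G : Graph n) where

  open DecMembership (_≟_ {n}) using (_∈?_)

  -- The list records the order of attachment, latest vertex first; this order later determines the
  -- colours inside the core.
  data Grown : List (Fin n) → Set where
    seed : ∀ v → Grown (v ∷ [])
    grow : ∀ {D x y} → x ∉ D → y ∈ D → Adj G x y → Grown D → Grown (x ∷ D)

  inhabited : ∀ {D} → Grown D → ∃ λ d → d ∈ D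
  inhabited (seed v)       = v , here refl
  inhabited (grow _ _ _ _) = _ , here refl

  Touches Dominated Near TwoNear : List (Fin n) → Fin n → Set
  Touches   D x = ∃ λ y → y ∈ D × Adj G x y
  Dominated D x = x ∈ D ⊎ Touches D x
  Near      D x = x ∉ D × Touches D x
  TwoNear   D x = ∃ λ p → ∃ λ q → p ≢ q × (Near D p × Adj G x p) × (Near D q × Adj G x q)

  touches? : ∀ D → Decidable (Touches D)
  touches? D x = any? λ y → (y ∈? D) ×-dec adjacent? G x y

  dominated? : ∀ D → Decidable (Dominated D)
  dominated? D x = (x ∈? D) ⊎-dec touches? D x

  near? : ∀ D → Decidable (Near D)
  near? D x = ¬? (x ∈? D) ×-dec touches? D x

  twoNear? : ∀ D → Decidable (TwoNear D)
  twoNear? D x = any? λ p → any? λ q → ¬? (p ≟ q) ×-dec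
    ((near? D p ×-dec adjacent? G x p) ×-dec (near? D q ×-dec adjacent? G x q))

  -- The stored witnesses steer the colouring: the neighbour in `near` is the distinguished one of
  -- `leg`, and the first near neighbour in `far` is the one of `hook`.
  data Place (D : List (Fin n)) (x : Fin n) : Set where
    core : x ∈ D → Place D x
    near : x ∉ D → Touches D x → Place D x
    far  : x ∉ D → ¬ Touches D x → TwoNear D x → Place D x

  crossing : {Q : Fin n → Set} → Decidable Q → ∀ {u v} → Walk G u v → Q u → ¬ Q v →
    ∃ λ s → ∃ λ t → Adj G s t × Q s × ¬ Q t
  crossing Q? ε       q ¬q = contradiction q ¬q
  crossing Q? (_◅_ {j = t} e w) q ¬q with Q? t
  ... | yes qt = crossing Q? w qt ¬q
  ... | no ¬qt = _ , t , e , q , ¬qt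

  dominated-∷ : ∀ {D x} → Dominated D ⊆ Dominated (x ∷ D)
  dominated-∷ (inj₁ ∈D)            = inj₁ (there ∈D)
  dominated-∷ (inj₂ (y , ∈D , e)) = inj₂ (y , there ∈D , e)

  Closed : Fin n → Fin n → Set
  Closed x y = y ≡ x ⊎ Adj G x y

  closed? : ∀ x → Decidable (Closed x)
  closed? x y = (y ≟ x) ⊎-dec adjacent? G x y

  closed⊆dominated : ∀ {D x} → Closed x ⊆ Dominated (x ∷ D)
  closed⊆dominated (inj₁ eq) = inj₁ (here eq)
  closed⊆dominated (inj₂ e)  = inj₂ (_ , here refl , symmetric G e)

  irrefl : ∀ {x} → ¬ Adj G x x
  irrefl = irreflexive G refl

  degree<closed : ∀ x → suc (degree G x) ≤ count (closed? x)
  degree<closed x = ℕₚ.≤-trans (ℕₚ.+-monoˡ-≤ (degree G x) (count-≡-≥1 x))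
    (length-filter-disjoint (_≟ x) (adjacent? G x) (closed? x)
      inj₁ inj₂ (λ { refl e → irrefl e }) (allFin n))

  -- Bounds the gain from adding a far vertex `x` to the core when one neighbour `y` of it is
  -- dominated already.
  degree≤closed-minus : ∀ x y → degree G x ≤ count (λ z → closed? x z ×-dec ¬? (z ≟ y))
  degree≤closed-minus x y = ℕₚ.+-cancelˡ-≤ 1 _ _ (begin
    suc (degree G x)                ≤⟨ degree<closed x ⟩
    count (closed? x)               ≤⟨ length-filter-cover (closed? x) (_≟ y) rest? split (allFin n) ⟩
    count (_≟ y) + count rest?      ≤⟨ ℕₚ.+-monoˡ-≤ _ (count-≡-≤1 y) ⟩
    suc (count rest?)               ∎)
    where
    open ℕₚ.≤-Reasoning
    rest? : Decidable (λ z → Closed x z × z ≢ y)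
    rest? z = closed? x z ×-dec ¬? (z ≟ y)
    split : ∀ {z} → Closed x z → z ≡ y ⊎ Closed x z × z ≢ y
    split {z} c with z ≟ y
    ... | yes eq = inj₁ eq
    ... | no neq = inj₂ (c , neq)

  count≤n : ∀ {P : Fin n → Set} (P? : Decidable P) → count P? ≤ n
  count≤n P? = ℕₚ.≤-trans (length-filter P? (allFin n)) (ℕₚ.≤-reflexive (length-tabulate {n = n} id))

  module _ (connected : Connected G) (δ : ℕ) (δ≥2 : 2 ≤ δ) (δ≤deg : ∀ v → δ ≤ degree G v) where

    -- The summand 2 is what the seed leaves over: a single vertex dominates `suc δ` vertices, which
    -- pays for three core vertices.
    Sparse : List (Fin n) → Set
    Sparse D = Grown D × (length D + 2) * suc δ ≤ 3 * count (dominated? D)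

    three-more : ∀ L c c′ → (L + 2) * suc δ ≤ 3 * c → c + suc δ ≤ c′ → (3 + L + 2) * suc δ ≤ 3 * c′
    three-more L c c′ h g = begin
      (3 + L + 2) * suc δ           ≡⟨ lemma L δ ⟩
      (L + 2) * suc δ + 3 * suc δ   ≤⟨ ℕₚ.+-monoˡ-≤ (3 * suc δ) h ⟩
      3 * c + 3 * suc δ             ≡⟨ ℕₚ.*-distribˡ-+ 3 c (suc δ) ⟨
      3 * (c + suc δ)               ≤⟨ ℕₚ.*-monoʳ-≤ 3 g ⟩
      3 * c′                        ∎
      where
      open ℕₚ.≤-Reasoning
      lemma : ∀ L δ → (3 + L + 2) * suc δ ≡ (L + 2) * suc δ + 3 * suc δ
      lemma = solve-∀

    -- Two vertices cost `2 * suc δ`, which is at most `3 * δ` exactly because `δ` is at least 2.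
    two-more : ∀ L c c′ → (L + 2) * suc δ ≤ 3 * c → c + δ ≤ c′ → (2 + L + 2) * suc δ ≤ 3 * c′
    two-more L c c′ h g = begin
      (2 + L + 2) * suc δ           ≡⟨ lemma L δ ⟩
      (L + 2) * suc δ + (2 + 2 * δ) ≤⟨ ℕₚ.+-mono-≤ h (ℕₚ.+-monoˡ-≤ (2 * δ) δ≥2) ⟩
      3 * c + 3 * δ                 ≡⟨ ℕₚ.*-distribˡ-+ 3 c δ ⟨
      3 * (c + δ)                   ≤⟨ ℕₚ.*-monoʳ-≤ 3 g ⟩
      3 * c′                        ∎
      where
      open ℕₚ.≤-Reasoning
      lemma : ∀ L δ → (2 + L + 2) * suc δ ≡ (L + 2) * suc δ + (2 + 2 * δ)
      lemma = solve-∀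

    -- Says that `s` has distance at least three from `D`.
    Remote : List (Fin n) → Fin n → Set
    Remote D s = ¬ ∃ λ y → Closed s y × Dominated D y

    remote? : ∀ D → Decidable (Remote D)
    remote? D s = ¬? (any? λ y → closed? s y ×-dec dominated? D y)

    -- On a walk from a remote vertex to the core, let `s` be remote and its successor `t` not. Then
    -- `s` has distance exactly three, and `s`, `t`, `y` attach it to `D`. Nothing in the closed
    -- neighbourhood of `s` was dominated before, so at least `suc δ` vertices are gained.
    attach-remote : ∀ {D s} → Sparse D → Remote D s → ∃ λ D′ → Sparse D′ × length D < length D′
    attach-remote {D} {s₀} (grown , sparse) remote₀
      with d , d∈D ← inhabited grown
      with s , t , s~t , remote , ¬remote ← crossing (remote? D) (proj₁ (connected s₀ d)) remote₀
             (λ r → r (d , inj₁ refl , inj₁ d∈D))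
      with decidable-stable (any? λ y → closed? t y ×-dec dominated? D y) ¬remote
    -- A dominated `t` would contradict the remoteness of its neighbour `s`.
    ... | y , inj₁ refl , dom = contradiction (t , inj₂ s~t , dom) remote
    ... | y , inj₂ t~y , inj₁ y∈D = contradiction (t , inj₂ s~t , inj₂ (y , y∈D , t~y)) remote
    ... | y , inj₂ t~y , inj₂ (z , z∈D , y~z) with y ∈? D
    ...   | yes y∈D = contradiction (t , inj₂ s~t , inj₂ (y , y∈D , t~y)) remote
    ...   | no  y∉D = s ∷ t ∷ y ∷ D ,
      ( grow s∉ (here refl) s~t (grow t∉ (here refl) t~y (grow y∉D z∈D y~z grown))
      , three-more (length D) _ _ sparse (ℕₚ.≤-trans
          (ℕₚ.+-monoʳ-≤ (count (dominated? D)) (ℕₚ.≤-trans (s≤s (δ≤deg s)) (degree<closed s)))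
          (length-filter-disjoint (dominated? D) (closed? s) (dominated? (s ∷ t ∷ y ∷ D))
            (dominated-∷ ∘ dominated-∷ ∘ dominated-∷) closed⊆dominated
            (λ dom cl → remote (_ , cl , dom)) (allFin n))))
      , s≤s (ℕₚ.m≤n+m _ 2)
      where
      t∉ : t ∉ y ∷ D
      t∉ (here refl) = irrefl t~y
      t∉ (there t∈D) = remote (t , inj₂ s~t , inj₁ t∈D)
      s∉ : s ∉ t ∷ y ∷ D
      s∉ (here refl)           = irrefl s~t
      s∉ (there (here refl))   = remote (s , inj₁ refl , inj₂ (z , z∈D , y~z))
      s∉ (there (there s∈D))   = remote (s , inj₁ refl , inj₁ s∈D)

    -- The only neighbour of `v` that is dominated already is `x`, since a second one would make `v`
    -- see two near vertices. Hence the closed neighbourhood of `v` without `x` is a gain of at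
    -- least `δ`.
    attach-far : ∀ {D v x} → Sparse D → v ∉ D → ¬ Touches D v → ¬ TwoNear D v → Near D x → Adj G v x →
      ∃ λ D′ → Sparse D′ × length D < length D′
    attach-far {D} {v} {x} (grown , sparse) v∉D ¬touches ¬two (x∉D , y , y∈D , x~y) v~x =
      v ∷ x ∷ D ,
      ( grow v∉ (here refl) v~x (grow x∉D y∈D x~y grown)
      , two-more (length D) _ _ sparse (ℕₚ.≤-trans
          (ℕₚ.+-monoʳ-≤ (count (dominated? D)) (ℕₚ.≤-trans (δ≤deg v) (degree≤closed-minus v x)))
          (length-filter-disjoint (dominated? D) (λ z → closed? v z ×-dec ¬? (z ≟ x))
            (dominated? (v ∷ x ∷ D))
            (dominated-∷ ∘ dominated-∷) (closed⊆dominated ∘ proj₁) disjoint (allFin n))))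
      , s≤s (ℕₚ.n≤1+n _)
      where
      v∉ : v ∉ x ∷ D
      v∉ (here refl) = irrefl v~x
      v∉ (there v∈D) = v∉D v∈D
      disjoint : ∀ {z} → Dominated D z → ¬ (Closed v z × z ≢ x)
      disjoint (inj₁ z∈D) (inj₁ refl , _)  = v∉D z∈D
      disjoint (inj₂ tch) (inj₁ refl , _)  = ¬touches tch
      disjoint (inj₁ z∈D) (inj₂ v~z , _)   = ¬touches (_ , z∈D , v~z)
      disjoint {z} (inj₂ tch) (inj₂ v~z , z≢x) with z ∈? D
      ... | yes z∈D = ¬touches (_ , z∈D , v~z)
      ... | no  z∉D = ¬two (z , x , z≢x , ((z∉D , tch) , v~z) , ((x∉D , y , y∈D , x~y) , v~x))

    -- A vertex without a place is outside `D`, not near, and has at most one near neighbour. With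
    -- one, it is attached through it; with none, it is remote.
    improve : ∀ {D} → Sparse D → (∃ λ D′ → Sparse D′ × length D < length D′) ⊎ (∀ x → Place D x)
    improve {D} sparse
      with any? (λ v → ¬? (v ∈? D) ×-dec (¬? (touches? D v) ×-dec ¬? (twoNear? D v)))
    ... | yes (v , v∉D , ¬touches , ¬two) with any? (λ x → near? D x ×-dec adjacent? G v x)
    ...   | yes (x , nx , v~x) = inj₁ (attach-far sparse v∉D ¬touches ¬two nx v~x)
    ...   | no  ¬near = inj₁ (attach-remote {s = v} sparse remote)
      where
      remote : Remote D v
      remote (y , inj₁ refl , inj₁ v∈D) = v∉D v∈D
      remote (y , inj₁ refl , inj₂ tch) = ¬touches tch
      remote (y , inj₂ v~y  , inj₁ y∈D) = ¬touches (y , y∈D , v~y)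
      remote (y , inj₂ v~y  , inj₂ tch) with y ∈? D
      ... | yes y∈D = ¬touches (y , y∈D , v~y)
      ... | no  y∉D = ¬near (y , (y∉D , tch) , v~y)
    improve {D} sparse | no ¬bad = inj₂ place
      where
      place : ∀ x → Place D x
      place x with x ∈? D | touches? D x | twoNear? D x
      ... | yes x∈D | _        | _       = core x∈D
      ... | no  x∉D | yes tch  | _       = near x∉D tch
      ... | no  x∉D | no ¬tch  | yes two = far x∉D ¬tch two
      ... | no  x∉D | no ¬tch  | no ¬two = contradiction (x , x∉D , ¬tch , ¬two) ¬bad

    sparse-bound : ∀ {D} → Sparse D → (length D + 2) * suc δ ≤ 3 * n
    sparse-bound {D} (_ , sparse) = ℕₚ.≤-trans sparse (ℕₚ.*-monoʳ-≤ 3 (count≤n (dominated? D)))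

    sparse-length : ∀ {D} → Sparse D → length D ≤ 3 * n
    sparse-length {D} sparse =
      ℕₚ.≤-trans (ℕₚ.m≤m+n _ 2) (ℕₚ.≤-trans (ℕₚ.m≤m*n (length D + 2) (suc δ)) (sparse-bound sparse))

    sparse-core : Fin n → ∃ λ D → Grown D × (length D + 2) * suc δ ≤ 3 * n × (∀ x → Place D x)
    sparse-core v = loop (3 * n) start (ℕₚ.n<1+n (3 * n))
      where
      start : Sparse (v ∷ [])
      start = seed v , ℕₚ.*-monoʳ-≤ 3 (ℕₚ.≤-trans (s≤s (δ≤deg v)) (ℕₚ.≤-trans (degree<closed v)
        -- With an empty second predicate, the count of disjoint sets becomes monotonicity of
        -- counting.
        (ℕₚ.≤-trans (ℕₚ.m≤m+n _ _) (length-filter-disjoint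
          (closed? v) (λ _ → no id) (dominated? (v ∷ []))
          closed⊆dominated (λ ()) (λ _ ()) (allFin n)))))
      -- The sum of length and fuel never decreases and exceeds `3 * n`, whereas a sparse core has
      -- length at most `3 * n`; so the fuel cannot run out.
      loop : ∀ fuel {D} → Sparse D → 3 * n < length D + fuel →
        ∃ λ D → Grown D × (length D + 2) * suc δ ≤ 3 * n × (∀ x → Place D x)
      loop zero {D} sparse enough =
        contradiction (sparse-length sparse) (ℕₚ.<⇒≱ (subst (3 * n <_) (ℕₚ.+-identityʳ _) enough))
      loop (suc fuel) {D} sparse enough with improve sparse
      ... | inj₂ place = D , proj₁ sparse , sparse-bound sparse , place
      ... | inj₁ (D′ , sparse′ , longer) = loop fuel sparse′ (ℕₚ.<-≤-trans enough
              (ℕₚ.≤-trans (ℕₚ.≤-reflexive (ℕₚ.+-suc (length D) fuel)) (ℕₚ.+-monoˡ-≤ fuel longer)))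

-- Palettes of the routes to the core

bit : Bool → ℕ
bit false = 0
bit true  = 1

-- The possible lists of palettes through which a vertex can be joined to the
-- core: for a core vertex, a near vertex of either side, a far vertex seeing
-- both sides, and a far vertex seeing one side only.
near-profile unmixed-profile : Bool → List (List ℕ)
near-profile    t = (bit t ∷ []) ∷ (2 ∷ 3 ∷ bit (not t) ∷ []) ∷ []
unmixed-profile t = (4 ∷ bit t ∷ []) ∷ (5 ∷ bit t ∷ []) ∷ (4 ∷ 2 ∷ 3 ∷ bit (not t) ∷ []) ∷ []

core-profile mixed-profile : List (List ℕ)
core-profile  = [] ∷ []
mixed-profile = (2 ∷ 0 ∷ []) ∷ (3 ∷ 1 ∷ []) ∷ []

profiles : List (List (List ℕ))
profiles = core-profile ∷ near-profile false ∷ near-profile true ∷ mixed-profile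
         ∷ unmixed-profile false ∷ unmixed-profile true ∷ []

-- Besides being disjoint, both palettes stay below 6, away from the colours of the core trail that
-- joins the two routes.
Compatible : List ℕ → List ℕ → Set
Compatible S T = All (λ k → k < 6 × k ∉ T) S × All (_< 6) T

abstract
  -- A finite check of all 36 pairs by evaluation. Pairs of equal profiles matter too: two one-sided
  -- far vertices of the same side `t` use 5, `bit t` against 4, 2, 3, `bit (not t)`.
  profiles-compatible : All (λ p → All (λ q → Any (λ S → Any (Compatible S) q) p) profiles) profiles
  profiles-compatible = from-yes
    (All.all? (λ p → All.all? (λ q → Any.any? (λ S → Any.any? (compatible? S) q) p) profiles) profiles)
    where
    open DecMembership ℕ._≟_ using (_∈?_)
    compatible? : ∀ S T → Dec (Compatible S T)
    compatible? S T = All.all? (λ k → (k ℕ.<? 6) ×-dec ¬? (k ∈? T)) S ×-dec All.all? (ℕ._<? 6) T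

-- Colouring the core

module _ {n} (G : Graph n) where

  -- The position in D of the endpoint added last: positive on every edge of the
  -- core, so that adding 5 avoids the colours 0, …, 5.
  coreColour : List (Fin n) → Fin n → Fin n → ℕ
  coreColour []      u v = 0
  coreColour (x ∷ D) u v with does ((u ≟ x) ⊎-dec (v ≟ x))
  ... | true  = length D
  ... | false = coreColour D u v

  coreColour-sym : ∀ D u v → coreColour D u v ≡ coreColour D v u
  coreColour-sym []      u v = refl
  coreColour-sym (x ∷ D) u v with u ≟ x | v ≟ x
  ... | yes _ | yes _ = refl
  ... | yes _ | no  _ = refl
  ... | no  _ | yes _ = refl
  ... | no  _ | no  _ = coreColour-sym D u v

  coreColour-≤ : ∀ D u v → coreColour D u v ≤ length D
  coreColour-≤ []      u v = z≤n
  coreColour-≤ (x ∷ D) u v with does ((u ≟ x) ⊎-dec (v ≟ x))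
  ... | true  = ℕₚ.n≤1+n _
  ... | false = ℕₚ.m≤n⇒m≤1+n (coreColour-≤ D u v)

  coreColour-< : ∀ {D} → Grown G D → ∀ u v → coreColour D u v < length D
  coreColour-< {x ∷ D} _ u v with does ((u ≟ x) ⊎-dec (v ≟ x))
  ... | true  = ℕₚ.n<1+n _
  ... | false = s≤s (coreColour-≤ D u v)

  coreColour-new : ∀ x D v → coreColour (x ∷ D) x v ≡ length D
  coreColour-new x D v with x ≟ x
  ... | yes _  = refl
  ... | no neq = contradiction refl neq

  coreColour-old : ∀ {x D u v} → x ∉ D → u ∈ D → v ∈ D → coreColour (x ∷ D) u v ≡ coreColour D u v
  coreColour-old {x} {D} {u} {v} x∉D u∈D v∈D with u ≟ x | v ≟ x
  ... | yes refl | _        = contradiction u∈D x∉D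
  ... | no _     | yes refl = contradiction v∈D x∉D
  ... | no _     | no _     = refl

  CoreEdge : List (Fin n) → Fin n → Fin n → ℕ → Set
  CoreEdge D u v k = (u ∈ D × v ∈ D) × Adj G u v × coreColour D u v ≡ k

  coreEdge-sym : ∀ {D u v k} → CoreEdge D u v k → CoreEdge D v u k
  coreEdge-sym {D} {u} {v} ((u∈ , v∈) , e , eq) =
    (v∈ , u∈) , symmetric G e , trans (coreColour-sym D v u) eq

  -- Induction on the growth: the edge attaching `x` gets the colour `length D`, which is larger
  -- than every colour used by the older trails, and positive since `D` contains `y`.
  core-rainbow : ∀ {D} → Grown G D → ∀ {u v} → u ∈ D → v ∈ D →
    Rainbow (CoreEdge D) (λ k → 1 ≤ k × k < length D) u v
  core-rainbow (seed _) (here refl) (here refl) = rainbow-refl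
  core-rainbow (grow {D} {x} {y} x∉D y∈D x~y grown) = join
    where
    lift : ∀ {u v k} → CoreEdge D u v k → CoreEdge (x ∷ D) u v k
    lift ((u∈ , v∈) , e , eq) = (there u∈ , there v∈) , e , trans (coreColour-old x∉D u∈ v∈) eq
    from-new : ∀ {v} → v ∈ D → Rainbow (CoreEdge (x ∷ D)) (λ k → 1 ≤ k × k < suc (length D)) x v
    from-new v∈D = rainbow-map id
      (λ { (inj₁ refl) → ∈-length y∈D , ℕₚ.n<1+n _ ; (inj₂ (l , u)) → l , ℕₚ.m<n⇒m<1+n u })
      (rainbow-trans {Q = λ k → 1 ≤ k × k < length D} (λ { refl (_ , lt) → ℕₚ.n≮n _ lt })
        (rainbow-edge {P = _≡ length D} ((here refl , there y∈D) , x~y , coreColour-new x D y) refl)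
        (rainbow-map lift id (core-rainbow grown y∈D v∈D)))
    join : ∀ {u v} → u ∈ x ∷ D → v ∈ x ∷ D →
      Rainbow (CoreEdge (x ∷ D)) (λ k → 1 ≤ k × k < suc (length D)) u v
    join (here refl) (here refl) = rainbow-refl
    join (here refl) (there v∈D) = from-new v∈D
    join (there u∈D) (here refl) = rainbow-sym coreEdge-sym (from-new u∈D)
    join (there u∈D) (there v∈D) =
      rainbow-map lift (λ (l , u) → l , ℕₚ.m<n⇒m<1+n u) (core-rainbow grown u∈D v∈D)

  -- Colouring the whole graph

  another-neighbour : ∀ {x} → 2 ≤ degree G x → ∀ y → ∃ λ z → Adj G x z × z ≢ y
  another-neighbour {x} deg≥2 y with any? (λ z → adjacent? G x z ×-dec ¬? (z ≟ y))
  ... | yes found = found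
  ... | no ¬found = contradiction (unique-constant⇒length≤1
          (Uniqueₚ.filter⁺ (adjacent? G x) (Uniqueₚ.allFin⁺ n))
          (All.map (λ {z} x~z → decidable-stable (z ≟ y) (λ z≢y → ¬found (z , x~z , z≢y)))
            (Allₚ.all-filter (adjacent? G x) (allFin n))))
        (ℕₚ.<⇒≱ deg≥2)

  module _ {D} (grown : Grown G D) (place : ∀ x → Place G D x) (deg≥2 : ∀ x → 2 ≤ degree G x) where

    open DecMembership (_≟_ {n}) using (_∈?_)

    Far : Fin n → Set
    Far v = v ∉ D × ¬ Touches G D v

    far? : Decidable Far
    far? v = ¬? (v ∈? D) ×-dec ¬? (touches? G D v)

    Linked : Fin n → Fin n → Set
    Linked x y = x ≢ y × (Near G D x × Near G D y) × (Adj G x y ⊎ ∃ λ v → Far v × Adj G v x × Adj G v y)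

    linked? : ∀ x y → Dec (Linked x y)
    linked? x y = ¬? (x ≟ y) ×-dec ((near? G D x ×-dec near? G D y) ×-dec
      (adjacent? G x y ⊎-dec any? λ v → far? v ×-dec (adjacent? G v x ×-dec adjacent? G v y)))

    linked-sym : ∀ {x y} → Linked x y → Linked y x
    linked-sym (x≢y , (nx , ny) , inj₁ e) = x≢y ∘ sym , (ny , nx) , inj₁ (symmetric G e)
    linked-sym (x≢y , (nx , ny) , inj₂ (v , fv , e , f)) = x≢y ∘ sym , (ny , nx) , inj₂ (v , fv , f , e)

    abstract
      sides : ∃ λ (side : Fin n → Bool) → ∀ {x y} → Linked x y → ∃ λ z → Linked x z × side z ≡ not (side x)
      sides = opposite-neighbours linked? linked-sym (λ (x≢x , _) → x≢x refl)

    side : Fin n → Bool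
    side = proj₁ sides

    Mixed : Fin n → Set
    Mixed v = ∃ λ x → ∃ λ y → (Near G D x × Near G D y) × (Adj G v x × Adj G v y) × side y ≡ not (side x)

    mixed? : Decidable Mixed
    mixed? v = any? λ x → any? λ y → (near? G D x ×-dec near? G D y) ×-dec
      ((adjacent? G v x ×-dec adjacent? G v y) ×-dec (side y Boolₚ.≟ not (side x)))

    -- The colour of the edge from a near vertex x to d ∈ D, where f ∈ D is a
    -- distinguished neighbour of x.
    leg : Fin n → Fin n → Fin n → ℕ
    leg x f d = bit (if does (d ≟ f) then side x else not (side x))

    -- The colour of the edge from a far vertex v to a near vertex x, where p
    -- is a distinguished near neighbour of v.
    hook : Fin n → Fin n → Fin n → ℕ
    hook v p x = if does (mixed? v) then 2 + bit (side x) else if does (x ≟ p) then 4 else 5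

    placedColour : ∀ {u v} → Place G D u → Place G D v → ℕ
    placedColour {u} {v} (core _)              (core _)              = 5 + coreColour D u v
    placedColour {u} {v} (core _)              (near _ (f , _))      = leg v f u
    placedColour {u} {v} (near _ (f , _))      (core _)              = leg u f v
    placedColour {u} {v} (near _ _)            (near _ _)            = 3
    placedColour {u} {v} (near _ _)            (far _ _ (p , _))     = hook v p u
    placedColour {u} {v} (far _ _ (p , _))     (near _ _)            = hook u p v
    -- Here 0 is a default value: no edge joins the core to a far vertex, and the routes to the core
    -- never follow an edge between two far vertices.
    placedColour {u} {v} (core _)              (far _ _ _)           = 0
    placedColour {u} {v} (far _ _ _)           (core _)              = 0
    placedColour {u} {v} (far _ _ _)           (far _ _ _)           = 0

    placedColour-sym : ∀ {u v} (P : Place G D u) (Q : Place G D v) → placedColour P Q ≡ placedColour Q P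
    placedColour-sym {u} {v} (core _)    (core _)    = cong (_+_ 5) (coreColour-sym D u v)
    placedColour-sym         (core _)    (near _ _)  = refl
    placedColour-sym         (core _)    (far _ _ _) = refl
    placedColour-sym         (near _ _)  (core _)    = refl
    placedColour-sym         (near _ _)  (near _ _)  = refl
    placedColour-sym         (near _ _)  (far _ _ _) = refl
    placedColour-sym         (far _ _ _) (core _)    = refl
    placedColour-sym         (far _ _ _) (near _ _)  = refl
    placedColour-sym         (far _ _ _) (far _ _ _) = refl

    bit≤1 : ∀ b → bit b ≤ 1
    bit≤1 false = z≤n
    bit≤1 true  = s≤s z≤n

    hook≤5 : ∀ v p x → hook v p x ≤ 5
    hook≤5 v p x with does (mixed? v) | does (x ≟ p)
    ... | true  | _     = ℕₚ.≤-trans (ℕₚ.+-monoʳ-≤ 2 (bit≤1 (side x))) (ℕₚ.m≤n+m 3 2)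
    ... | false | true  = ℕₚ.m≤n+m 4 1
    ... | false | false = ℕₚ.≤-refl

    -- The core is nonempty, so the colours 0 to 5 fit below `5 + length D`.
    5<colours : ∀ {k} → k ≤ 5 → k < 5 + length D
    5<colours k≤5 = ℕₚ.≤-trans (s≤s k≤5) (ℕₚ.+-monoʳ-≤ 5 (∈-length (proj₂ (inhabited G grown))))

    placedColour-< : ∀ {u v} (P : Place G D u) (Q : Place G D v) → placedColour P Q < 5 + length D
    placedColour-< {u} {v} (core _) (core _)    = ℕₚ.+-monoʳ-< 5 (coreColour-< grown u v)
    placedColour-< (core _)    (near _ _)  = 5<colours (ℕₚ.≤-trans (bit≤1 _) (s≤s z≤n))
    placedColour-< (core _)    (far _ _ _) = 5<colours z≤n
    placedColour-< (near _ _)  (core _)    = 5<colours (ℕₚ.≤-trans (bit≤1 _) (s≤s z≤n))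
    placedColour-< (near _ _)  (near _ _)  = 5<colours (ℕₚ.m≤n+m 3 2)
    placedColour-< {u} {v} (near _ _)  (far _ _ (p , _)) = 5<colours (hook≤5 v p u)
    placedColour-< (far _ _ _) (core _)    = 5<colours z≤n
    placedColour-< {u} {v} (far _ _ (p , _)) (near _ _)  = 5<colours (hook≤5 u p v)
    placedColour-< (far _ _ _) (far _ _ _) = 5<colours z≤n

    Edge : Fin n → Fin n → ℕ → Set
    Edge u v k = Adj G u v × placedColour (place u) (place v) ≡ k

    edge-sym : ∀ {u v k} → Edge u v k → Edge v u k
    edge-sym (e , eq) = symmetric G e , trans (placedColour-sym (place _) (place _)) eq

    core-edge : ∀ {u v k} → CoreEdge D u v k → ∃ λ l → Edge u v l × l ≡ 5 + k
    core-edge {u} {v} ((u∈ , v∈) , e , refl) = _ , (e , colour-core (place u) (place v)) , refl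
      where
      colour-core : (P : Place G D u) (Q : Place G D v) → placedColour P Q ≡ 5 + coreColour D u v
      colour-core (core _)      (core _)      = refl
      colour-core (near u∉ _)   _             = contradiction u∈ u∉
      colour-core (far u∉ _ _)  _             = contradiction u∈ u∉
      colour-core (core _)      (near v∉ _)   = contradiction v∈ v∉
      colour-core (core _)      (far v∉ _ _)  = contradiction v∈ v∉

    -- Reads off the neighbour `f` stored in `place x`. Its edge gives the direct route to the core;
    -- any second edge to the core gives a route avoiding the colour of the side of `x`.
    legs : ∀ {x} → Near G D x → ∃ λ f → f ∈ D × Edge x f (bit (side x)) ×
      (∀ {d} → d ∈ D → Adj G x d → d ≢ f → Edge x d (bit (not (side x))))
    legs {x} (x∉ , tch) = go (place x) refl
      where
      colour-leg : ∀ {f d} {f-ok} → d ∈ D → (Q : Place G D d) →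
        placedColour (near {x = x} x∉ (f , f-ok)) Q ≡ leg x f d
      colour-leg d∈ (core _)     = refl
      colour-leg d∈ (near d∉ _)  = contradiction d∈ d∉
      colour-leg d∈ (far d∉ _ _) = contradiction d∈ d∉
      go : (P : Place G D x) → place x ≡ P → ∃ λ f → f ∈ D × Edge x f (bit (side x)) ×
        (∀ {d} → d ∈ D → Adj G x d → d ≢ f → Edge x d (bit (not (side x))))
      go (core x∈)      _  = contradiction x∈ x∉
      go (far _ ¬tch _) _  = contradiction tch ¬tch
      go (near x∉′ (f , f∈ , e)) eq = f , f∈ , (e , own) , λ {d} d∈ x~d d≢f → x~d , other d∈ d≢f
        where
        leg-colour : ∀ {d} → d ∈ D → placedColour (place x) (place d) ≡ leg x f d
        leg-colour {d} d∈ rewrite eq = colour-leg d∈ (place d)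
        own : placedColour (place x) (place f) ≡ bit (side x)
        own = trans (leg-colour f∈)
          (cong (λ b → bit (if b then side x else not (side x))) (dec-true (f ≟ f) refl))
        other : ∀ {d} → d ∈ D → d ≢ f → placedColour (place x) (place d) ≡ bit (not (side x))
        other {d} d∈ d≢f = trans (leg-colour d∈)
          (cong (λ b → bit (if b then side x else not (side x))) (dec-false (d ≟ f) d≢f))

    near-near : ∀ {x y} → Near G D x → Near G D y → Adj G x y → Edge x y 3
    near-near {x} {y} (x∉ , tx) (y∉ , ty) e = e , go (place x) (place y)
      where
      go : (P : Place G D x) (Q : Place G D y) → placedColour P Q ≡ 3
      go (near _ _)     (near _ _)     = refl
      go (core x∈)      _              = contradiction x∈ x∉
      go (far _ ¬tx _)  _              = contradiction tx ¬tx
      go (near _ _)     (core y∈)      = contradiction y∈ y∉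
      go (near _ _)     (far _ ¬ty _)  = contradiction ty ¬ty

    hooks : ∀ {v} → Far v → ∃ λ p → ∃ λ q → p ≢ q × (Near G D p × Adj G v p) × (Near G D q × Adj G v q) ×
      (∀ {x} → Near G D x → Adj G v x → Edge v x (hook v p x))
    hooks {v} (v∉ , ¬tv) = go (place v) refl
      where
      go : (P : Place G D v) → place v ≡ P → ∃ λ p → ∃ λ q → p ≢ q ×
        (Near G D p × Adj G v p) × (Near G D q × Adj G v q) ×
        (∀ {x} → Near G D x → Adj G v x → Edge v x (hook v p x))
      go (core v∈)   _ = contradiction v∈ v∉
      go (near _ tv) _ = contradiction tv ¬tv
      go (far _ _ (p , q , p≢q , np , nq)) eq = p , q , p≢q , np , nq , λ {x} nx e → e , colour-hook nx
        where
        colour-hook : ∀ {x} → Near G D x → placedColour (place v) (place x) ≡ hook v p x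
        colour-hook {x} (x∉ , tx) rewrite eq with place x
        ... | near _ _    = refl
        ... | core x∈     = contradiction x∈ x∉
        ... | far _ ¬tx _ = contradiction tx ¬tx

    -- Routes to the core

    -- The trail may use only part of `S`, so that different detours can share one palette.
    Route : Fin n → List ℕ → Set
    Route v S = ∃ λ d → d ∈ D × Rainbow Edge (_∈ S) v d

    route-∷ : ∀ {u v k S} → k ∉ S → Edge u v k → Route v S → Route u (k ∷ S)
    route-∷ k∉S e (d , d∈ , r) = d , d∈ , rainbow-map id [ here , there ]′
      (rainbow-trans (λ { refl → k∉S }) (rainbow-edge {P = _≡ _} e refl) r)

    route-⊆ : ∀ {v S T} → (∀ {k} → k ∈ S → k ∈ T) → Route v S → Route v T
    route-⊆ S⊆T (d , d∈ , r) = d , d∈ , rainbow-map id S⊆T r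

    direct : ∀ {x} → Near G D x → Route x (bit (side x) ∷ [])
    direct nx with f , f∈ , e , _ ← legs nx = f , f∈ , rainbow-edge e (here refl)

    bit∉ : ∀ {k} b → 2 ≤ k → k ∉ bit b ∷ []
    bit∉ b 2≤k (here refl) = ℕₚ.<⇒≱ 2≤k (bit≤1 b)

    mixed-hook : ∀ {v x} → Far v → Mixed v → Near G D x → Adj G v x → Edge v x (2 + bit (side x))
    mixed-hook {v} {x} fv mv nx e with p , _ , _ , _ , _ , colour-hook ← hooks fv =
      e , trans (proj₂ (colour-hook nx e))
        (cong (λ b → if b then 2 + bit (side x) else if does (x ≟ p) then 4 else 5) (dec-true (mixed? v) mv))

    mixed-route : ∀ {v x} → Far v → Mixed v → Near G D x → Adj G v x →
      Route v (2 + bit (side x) ∷ bit (side x) ∷ [])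
    mixed-route fv mv nx e =
      route-∷ (bit∉ (side _) (s≤s (s≤s z≤n))) (mixed-hook fv mv nx e) (direct nx)

    -- The route crosses to `y` and descends by the colour of the side of `y`. An edge between `x`
    -- and `y` has colour 3. A common far neighbour sees both sides, hence is mixed, and its two
    -- edges have the colours 2 and 3 in some order.
    linked-around : ∀ {x y} → Linked x y → side y ≡ not (side x) → Route x (2 ∷ 3 ∷ bit (not (side x)) ∷ [])
    linked-around {x} {y} (_ , (nx , ny) , inj₁ e) opp rewrite sym opp =
      route-⊆ there (route-∷ (bit∉ (side y) (s≤s (s≤s z≤n))) (near-near nx ny e) (direct ny))
    linked-around {x} {y} (_ , (nx , ny) , inj₂ (v , fv , e , f)) opp =
      route-⊆ (reorder (side x)) (route-∷ (fresh (side x)) (edge-sym (mixed-hook fv mv nx e))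
        (subst (λ b → Route v (2 + bit b ∷ bit b ∷ [])) opp (mixed-route fv mv ny f)))
      where
      mv : Mixed v
      mv = x , y , (nx , ny) , (e , f) , opp
      fresh : ∀ b → 2 + bit b ∉ 2 + bit (not b) ∷ bit (not b) ∷ []
      fresh false (there (there ()))
      fresh true  (there (there ()))
      reorder : ∀ b {k} → k ∈ 2 + bit b ∷ 2 + bit (not b) ∷ bit (not b) ∷ [] → k ∈ 2 ∷ 3 ∷ bit (not b) ∷ []
      reorder false k∈                 = k∈
      reorder true  (here eq)          = there (here eq)
      reorder true  (there (here eq))  = here eq
      reorder true  (there (there k∈)) = there (there k∈)

    -- A second neighbour `z` of `x`, other than `f`, either lies in the core and gives a second
    -- leg, or shows that `x` has a link; the choice of sides then supplies a link to the other
    -- side.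
    around : ∀ {x} → Near G D x → Route x (2 ∷ 3 ∷ bit (not (side x)) ∷ [])
    around {x} nx@(x∉ , tx)
      with f , _ , _ , others ← legs nx
      with z , x~z , z≢f ← another-neighbour (deg≥2 x) f = go (place z)
      where
      via : ∀ {y} → Linked x y → Route x (2 ∷ 3 ∷ bit (not (side x)) ∷ [])
      via l with y , l′ , opp ← proj₂ sides l = linked-around l′ opp
      go : Place G D z → Route x (2 ∷ 3 ∷ bit (not (side x)) ∷ [])
      go (core z∈)    = z , z∈ , rainbow-edge (others z∈ x~z z≢f) (there (there (here refl)))
      go (near z∉ tz) = via {z} ((λ { refl → irrefl G x~z }) , (nx , (z∉ , tz)) , inj₁ x~z)
      -- Of the two near neighbours of `z`, at least one differs from `x` and is linked to it
      -- through `z`.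
      go (far z∉ ¬tz (p , q , p≢q , (np , z~p) , (nq , z~q))) with x ≟ p
      ... | no  x≢p  = via (x≢p , (nx , np) , inj₂ (z , (z∉ , ¬tz) , symmetric G x~z , z~p))
      ... | yes refl = via (p≢q , (nx , nq) , inj₂ (z , (z∉ , ¬tz) , symmetric G x~z , z~q))

    Profiled : Fin n → Set
    Profiled v = ∃ λ p → p ∈ profiles × All (Route v) p

    -- Since `v` is not mixed, `p` and `q` lie on the same side. The edge to `p` has colour 4 and
    -- the edge to `q` colour 5; the third route enters `p` and continues by the detour of `p`.
    unmixed-profiled : ∀ {v} → Far v → ¬ Mixed v → ∃ λ t → All (Route v) (unmixed-profile t)
    unmixed-profiled {v} fv ¬mv
      with p , q , p≢q , (np , v~p) , (nq , v~q) , colour-hook ← hooks fv =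
      side p , route-∷ (bit∉ (side p) (s≤s (s≤s z≤n))) p-edge (direct np)
             ∷ route-∷ (bit∉ (side p) (s≤s (s≤s z≤n))) q-edge
                 (subst (λ b → Route q (bit b ∷ [])) q-side (direct nq))
             ∷ route-∷ 4∉ p-edge (around np) ∷ []
      where
      unmixed-hook : ∀ x → hook v p x ≡ (if does (x ≟ p) then 4 else 5)
      unmixed-hook x = cong (λ b → if b then 2 + bit (side x) else if does (x ≟ p) then 4 else 5)
        (dec-false (mixed? v) ¬mv)
      p-edge : Edge v p 4
      p-edge = v~p , trans (proj₂ (colour-hook np v~p))
        (trans (unmixed-hook p) (cong (if_then 4 else 5) (dec-true (p ≟ p) refl)))
      q-edge : Edge v q 5
      q-edge = v~q , trans (proj₂ (colour-hook nq v~q))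
        (trans (unmixed-hook q) (cong (if_then 4 else 5) (dec-false (q ≟ p) (p≢q ∘ sym))))
      q-side : side q ≡ side p
      q-side = trans (Boolₚ.¬-not (λ eq → ¬mv (p , q , (np , nq) , (v~p , v~q) , eq))) (Boolₚ.not-involutive _)
      4∉ : 4 ∉ 2 ∷ 3 ∷ bit (not (side p)) ∷ []
      4∉ (there (there k∈)) = bit∉ (not (side p)) (s≤s (s≤s z≤n)) k∈

    profiled : ∀ v → Profiled v
    profiled v = go (place v)
      where
      near-listed : ∀ t → near-profile t ∈ profiles
      near-listed false = there (here refl)
      near-listed true  = there (there (here refl))
      unmixed-listed : ∀ t → unmixed-profile t ∈ profiles
      unmixed-listed false = there (there (there (there (here refl))))
      unmixed-listed true  = there (there (there (there (there (here refl)))))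
      both-hooks : ∀ {t t′} → t′ ≡ not t → Route v (2 + bit t ∷ bit t ∷ []) →
        Route v (2 + bit t′ ∷ bit t′ ∷ []) → All (Route v) mixed-profile
      both-hooks {false} refl r r′ = r ∷ r′ ∷ []
      both-hooks {true}  refl r r′ = r′ ∷ r ∷ []
      mixed-profiled : Far v → Mixed v → All (Route v) mixed-profile
      mixed-profiled fv mv@(_ , _ , (nx , ny) , (e , f) , opp) =
        both-hooks opp (mixed-route fv mv nx e) (mixed-route fv mv ny f)
      go : Place G D v → Profiled v
      go (core v∈) = core-profile , here refl , (v , v∈ , rainbow-refl) ∷ []
      go (near v∉ tv) = near-profile (side v) , near-listed (side v) ,
        direct (v∉ , tv) ∷ around (v∉ , tv) ∷ []
      go (far v∉ ¬tv _) with mixed? v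
      ... | yes mv = mixed-profile , there (there (there (here refl))) , mixed-profiled (v∉ , ¬tv) mv
      ... | no ¬mv with t , routes ← unmixed-profiled (v∉ , ¬tv) ¬mv =
              unmixed-profile t , unmixed-listed t , routes

    -- Joining routes through the core

    core-rainbow′ : ∀ {d e} → d ∈ D → e ∈ D → Rainbow Edge (6 ≤_) d e
    core-rainbow′ d∈ e∈ = shift (core-rainbow grown d∈ e∈)
      where
      shift : ∀ {d e} → Rainbow (CoreEdge D) (λ k → 1 ≤ k × k < length D) d e → Rainbow Edge (6 ≤_) d e
      shift (ks , t , uniq , ps) = map (_+_ 5) ks , shift-trail t , Uniqueₚ.map⁺ (ℕₚ.+-cancelˡ-≡ 5 _ _) uniq ,
        shift-All ps
        where
        shift-trail : ∀ {u v ks} → Trail (CoreEdge D) u v ks → Trail Edge u v (map (_+_ 5) ks)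
        shift-trail []      = []
        shift-trail (e ∷ t) with _ , e′ , refl ← core-edge e = e′ ∷ shift-trail t
        shift-All : ∀ {ks} → All (λ k → 1 ≤ k × k < length D) ks → All (6 ≤_) (map (_+_ 5) ks)
        shift-All []             = []
        shift-All ((l , _) ∷ ps) = ℕₚ.+-monoʳ-≤ 5 l ∷ shift-All ps

    -- Three trails are concatenated: the route of `u`, a trail inside the core, and the reversed
    -- route of `v`. Their palettes `S`, the numbers from 6 on, and `T` are pairwise disjoint.
    join-routes : ∀ {u v S T} → Compatible S T → Route u S → Route v T → Rainbow Edge (λ _ → ⊤) u v
    join-routes (S-ok , T<6) (d , d∈ , r) (e , e∈ , s) =
      rainbow-map id _ (rainbow-trans disjoint
        (rainbow-trans (λ k∈S 6≤k → ℕₚ.<⇒≱ (proj₁ (All.lookup S-ok k∈S)) 6≤k) r (core-rainbow′ d∈ e∈))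
        (rainbow-sym edge-sym s))
      where
      disjoint : ∀ {k} → k ∈ _ ⊎ 6 ≤ k → ¬ k ∈ _
      disjoint (inj₁ k∈S) k∈T = proj₂ (All.lookup S-ok k∈S) k∈T
      disjoint (inj₂ 6≤k) k∈T = ℕₚ.<⇒≱ (All.lookup T<6 k∈T) 6≤k

    rainbow : ∀ u v → Rainbow Edge (λ _ → ⊤) u v
    rainbow u v
      with p , p∈ , routes ← profiled u | q , q∈ , routes′ ← profiled v
      with S , S∈ , found ← find (All.lookup (All.lookup profiles-compatible p∈) q∈)
      with T , T∈ , ok ← find found =
      join-routes ok (All.lookup routes S∈) (All.lookup routes′ T∈)

    colouring : EdgeColouring G (5 + length D)
    colouring = record
      { colour     = λ {u} {v} _ → fromℕ< (placedColour-< (place u) (place v))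
      ; undirected = λ {u} {v} _ _ → fromℕ<-cong _ _ (placedColour-sym (place u) (place v)) _ _
      }

    trail⇒walk : ∀ {u v ks} → Trail Edge u v ks → ∃ λ w → map toℕ (colours colouring {u} {v} w) ≡ ks
    trail⇒walk [] = ε , refl
    trail⇒walk ((e , refl) ∷ t) with w , eq ← trail⇒walk t = e ◅ w , cong₂ _∷_ (toℕ-fromℕ< _) eq

    colouring-rainbow : RainbowConnected colouring
    colouring-rainbow u v _ = path (rainbow u v)
      where
      path : Rainbow Edge (λ _ → ⊤) u v → ∃ (IsRainbowPath colouring {u} {v})
      path (ks , t , uniq , _) =
        let w , eq = trail⇒walk t
            w′ , w′-rainbow , _ = rainbowWalk⇒rainbowPath colouring w
              (Uniqueₚ.map⁻ (subst Unique (sym eq) uniq))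
        in w′ , w′-rainbow

-- Bounds on the two connection numbers

module _ {n} (G : Graph n) {δ} (minDegree : IsMinDegree G δ) where

  δ≤degree : ∀ v → δ ≤ degree G v
  δ≤degree v = proj₂ minDegree _ (v , refl)

  minDegree≤prc : ∀ {prc} → IsPrc G prc → δ ≤ prc
  minDegree≤prc ((c , proper , _) , _) with v , _ ← proj₁ minDegree =
    ℕₚ.≤-trans (δ≤degree v) (degree≤colours c proper v)

  -- The colouring has `5 + length D` colours: six outside the core and one fewer than `length D`
  -- inside. Splitting this as `length D + 2` plus 3 matches the bound on the core.
  rc-bound : ∀ {rc} → Connected G → 2 ≤ δ → IsRc G rc → rc * suc δ ≤ 3 * n + 3 * suc δ
  rc-bound {rc} connected δ≥2 (_ , minimal)
    with v , _ ← proj₁ minDegree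
    with D , grown , sparse , place ← sparse-core G connected δ δ≥2 δ≤degree v = begin
      rc * suc δ                          ≤⟨ ℕₚ.*-monoˡ-≤ (suc δ) (minimal _ rainbow-colouring) ⟩
      (5 + length D) * suc δ              ≡⟨ split (length D) δ ⟩
      (length D + 2) * suc δ + 3 * suc δ  ≤⟨ ℕₚ.+-monoˡ-≤ (3 * suc δ) sparse ⟩
      3 * n + 3 * suc δ                   ∎
    where
    open ℕₚ.≤-Reasoning
    deg≥2 : ∀ x → 2 ≤ degree G x
    deg≥2 x = ℕₚ.≤-trans δ≥2 (δ≤degree x)
    rainbow-colouring = _ , colouring-rainbow G grown place deg≥2
    split : ∀ l δ → (5 + l) * suc δ ≡ (l + 2) * suc δ + 3 * suc δ
    split = solve-∀

-- Arithmetic of the hypothesis and of the rational conclusion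

-- For `δ` equal to 0 the sign condition fails; for `δ` equal to 1 the square is 0, below 4.
≥√⇒2≤ : ∀ {δ} m → (+ δ ℤ.- 1ℤ) ≥√ (m + 4) → 2 ≤ δ
≥√⇒2≤ {0}          m (() , _)
≥√⇒2≤ {1}          m (_ , ℤ.+≤+ le) with () ← ℕₚ.≤-trans (ℕₚ.m≤n+m 4 m) le
≥√⇒2≤ {suc (suc _)} m _ = s≤s (s≤s z≤n)

/1-mono-≤ : ∀ {a b} → a ≤ b → + a / 1 ℚ.≤ + b / 1
/1-mono-≤ {a} {b} a≤b = ℚₚ.toℚᵘ-cancel-≤ (begin
  ℚ.toℚᵘ (+ a / 1)  ≃⟨ ℚₚ.toℚᵘ-fromℚᵘ (mkℚᵘ (+ a) 0) ⟩
  mkℚᵘ (+ a) 0      ≤⟨ ℚᵘ.*≤* (ℤₚ.*-monoʳ-≤-nonNeg 1ℤ (ℤ.+≤+ a≤b)) ⟩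
  mkℚᵘ (+ b) 0      ≃⟨ ℚₚ.toℚᵘ-fromℚᵘ (mkℚᵘ (+ b) 0) ⟨
  ℚ.toℚᵘ (+ b / 1)  ∎)
  where open ℚᵘₚ.≤-Reasoning

-- Among unnormalised rationals the inequality is a cross-multiplication, with no common factors to
-- cancel, and so reduces to the one in the natural numbers.
≤-fraction+3 : ∀ r a d → r * suc d ≤ a + 3 * suc d → + r / 1 ℚ.≤ + a / suc d ℚ.+ + 3 / 1
≤-fraction+3 r a d le = ℚₚ.toℚᵘ-cancel-≤ (begin
  ℚ.toℚᵘ (+ r / 1)                           ≃⟨ ℚₚ.toℚᵘ-fromℚᵘ (mkℚᵘ (+ r) 0) ⟩
  mkℚᵘ (+ r) 0                               ≤⟨ ℚᵘ.*≤* cross ⟩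
  mkℚᵘ (+ a) d ℚᵘ.+ mkℚᵘ (+ 3) 0             ≃⟨ ℚᵘₚ.+-cong (ℚₚ.toℚᵘ-fromℚᵘ (mkℚᵘ (+ a) d))
                                                          (ℚₚ.toℚᵘ-fromℚᵘ (mkℚᵘ (+ 3) 0)) ⟨
  ℚ.toℚᵘ (+ a / suc d) ℚᵘ.+ ℚ.toℚᵘ (+ 3 / 1) ≃⟨ ℚₚ.toℚᵘ-homo-+ (+ a / suc d) (+ 3 / 1) ⟨
  ℚ.toℚᵘ (+ a / suc d ℚ.+ + 3 / 1)           ∎)
  where
  open ℚᵘₚ.≤-Reasoning
  lhs : ∀ r d → r * (suc d * 1) ≡ r * suc d
  lhs = solve-∀
  rhs : ∀ a d → (a * 1 + 3 * suc d) * 1 ≡ a + 3 * suc d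
  rhs = solve-∀
  cross : + r ℤ.* + (suc d * 1) ℤ.≤ (+ a ℤ.* 1ℤ ℤ.+ + 3 ℤ.* + suc d) ℤ.* 1ℤ
  cross = subst₂ ℤ._≤_
    (trans (cong +_ (sym (lhs r d))) (ℤₚ.pos-* r (suc d * 1)))
    (trans (cong +_ (sym (rhs a d))) (trans (ℤₚ.pos-* (a * 1 + 3 * suc d) 1)
      (cong (ℤ._* 1ℤ) (trans (ℤₚ.pos-+ (a * 1) (3 * suc d))
        (cong₂ ℤ._+_ (ℤₚ.pos-* a 1) (ℤₚ.pos-* 3 (suc d)))))))
    (ℤ.+≤+ le)

theorem3p3 : ∀ (n : ℕ) (G : Graph n) (δ prc rc : ℕ) →
    Connected G →
    IsMinDegree G δ →
    IsPrc G prc →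
    IsRc G rc →
    (+ δ ℤ.- 1ℤ) ≥√ (3 ℕ.* n ℕ.+ 4) →
    (+ prc / 1) - (+ rc / 1) ≥ (+ δ / 1) - ((+ (3 ℕ.* n) / suc δ) ℚ.+ (+ 3 / 1))
theorem3p3 n G δ prc rc connected minDegree isPrc isRc dense =
  ℚₚ.+-mono-≤ (/1-mono-≤ (minDegree≤prc G minDegree isPrc))
    (ℚₚ.neg-antimono-≤ (≤-fraction+3 rc (3 * n) δ
      (rc-bound G minDegree connected (≥√⇒2≤ (3 * n) dense) isRc)))
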